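{- For every positive integer $n$, $$\sum_{j=0}^{n}\binom{n+j}{j}\binom{n}{j}(-1)^j\Bigl(1+j\bigl(H_{n+j}+H_{n-j}-2H_j\bigr)\Bigr)=(1+2n)\binom{2n}{n}(-1)^n-\frac32 n(1+n)(-1)^n\sum_{i=1}^{n}\frac{\binom{2i}{i}}{i}.$$
   Context: $H_m:=\sum_{k=1}^m \frac1k$ for $m\ge1$, and $H_0:=0$. -}

module Defs where

open import Data.Nat as ℕ using (ℕ; zero; suc)
open import Data.Integer as ℤ using (ℤ; +_)
open import Data.Rational using (ℚ; _+_; _*_; _-_; -_; 0ℚ; 1ℚ; _/_)

fromℕ : ℕ → ℚ
fromℕ n = (+ n) / 1

Σ0to : ℕ → (ℕ → ℚ) → ℚ
Σ0to zero    f = f 0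
Σ0to (suc n) f = Σ0to n f + f (suc n)

Σ1to : ℕ → (ℕ → ℚ) → ℚ
Σ1to zero    f = 0ℚ
Σ1to (suc n) f = Σ1to n f + f (suc n)

-- 1/k for k ≥ 1 (value at 0 is an unused junk value 0; only used for k ≥ 1)
inv : ℕ → ℚ
inv zero    = 0ℚ
inv (suc k) = (+ 1) / suc k

H : ℕ → ℚ
H m = Σ1to m inv


sgn : ℕ → ℚ
sgn zero    = 1ℚ
sgn (suc j) = - sgn j

{-# OPTIONS --safe #-}
module Submission where

-- Both sides satisfy the first-order recurrence
--   m X(m+1) + (m+2) X(m) = (3m+2)/2 · (-1)^m · C(2m+2, m+1)
-- and agree at n = 1, so they agree for all n ≥ 1.  For the right-hand side the recurrence is a
-- direct computation.  For the left-hand side it is creative telescoping: writing F(m,j) for the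
-- summand and L(m,j) = H(m+j) + H(m-j) - 2H(j), the Wilf–Zeilberger certificate
--   G(m,j) = C(m+j,j) C(m,j) (-1)^j (Q(j,m) L(m,j) + P(j,m)) / (m+1-j)²,
--   Q(j,m) = -2j²(j-1)(m+1-j),   P(j,m) = -2j((3j-2)m - 2(j-1)²),
-- satisfies m F(m+1,j) + (m+2) F(m,j) = G(m,j+1) - G(m,j) for j < m, so summing over j leaves
-- only the terms at j = m and j = m+1.  Every rational-function identity involved is verified by
-- clearing denominators and normalising with the ring solver.

open import Defs
open import Algebra.Bundles.Raw using (RawRing)
open import Level using (0ℓ)
open import Data.Integer using (+_)
open import Data.Rational using (ℚ; 1ℚ; _/_)

-- The summand, the certificate and the right-hand side are written once over an arbitrary raw
-- ring with rational constants, so that they serve both as rationals and as solver syntax.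
module Shapes (R : RawRing 0ℓ 0ℓ) (κ : ℚ → RawRing.Carrier R) where
  open RawRing R

  infixl 6 _-_
  _-_ : Carrier → Carrier → Carrier
  x - y = x + - y

  summand : Carrier → Carrier → Carrier → Carrier
  summand c j L = c * (κ 1ℚ + j * L)

  harmonic : Carrier → Carrier → Carrier → Carrier
  harmonic h₊ h₋ h = h₊ + h₋ - κ (fromℕ 2) * h

  Q P : Carrier → Carrier → Carrier
  Q j m = - (κ (fromℕ 2) * j * j * (j - κ 1ℚ) * (κ 1ℚ + m - j))
  P j m = - (κ (fromℕ 2) * j * ((κ (fromℕ 3) * j - κ (fromℕ 2)) * m - κ (fromℕ 2) * (j - κ 1ℚ) * (j - κ 1ℚ)))

  certificate : Carrier → Carrier → Carrier → Carrier → Carrier → Carrier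
  certificate c d j m L = c * (d * d) * (Q j m * L + P j m)

  rhs-shape : Carrier → Carrier → Carrier → Carrier → Carrier
  rhs-shape n c σ s = (κ 1ℚ + κ (fromℕ 2) * n) * c * σ - κ ((+ 3) / 2) * n * (κ 1ℚ + n) * σ * s

open import Algebra.Bundles using (CommutativeMonoid)
import Algebra.Properties.CommutativeSemigroup as CommSemigroupProperties
import Algebra.Properties.Group as GroupProperties
open import Data.Fin using (Fin; zero; suc; #_)
open import Data.Nat as ℕ using (ℕ; suc; _∸_)
open import Data.Nat.Combinatorics using (_C_; nC1≡n; nCn≡1; nCk+nC[k+1]≡[n+1]C[k+1])
open import Data.Nat.Combinatorics.Specification using (k>n⇒nCk≡0)
open import Data.Nat.Coprimality using (1-coprimeTo) renaming (sym to coprime-sym)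
import Data.Nat.Properties as ℕ
open import Data.Nat.Tactic.RingSolver using (solve-∀)
open import Data.Product using (Σ; _,_)
import Data.Integer as ℤ
import Data.Integer.Properties as ℤ
open import Data.Rational using (_+_; _*_; _-_; -_; 0ℚ; toℚᵘ)
import Data.Rational.Properties as ℚ
open import Data.Rational.Solver using (module +-*-Solver)
import Data.Rational.Unnormalised as ℚᵘ
import Data.Rational.Unnormalised.Properties as ℚᵘ
open import Data.Vec using (Vec; []; _∷_; lookup; zipWith; replicate)
open import Data.Vec.Relation.Binary.Pointwise.Inductive using (Pointwise; []; _∷_)
open import Function using (id; _∘_)
open import Relation.Binary.PropositionalEquality using (_≡_; refl; sym; trans; cong; cong₂; module ≡-Reasoning)
open ≡-Reasoning

private
  module Poly = +-*-Solver
  module ℚ* = CommSemigroupProperties (CommutativeMonoid.commutativeSemigroup ℚ.*-1-commutativeMonoid)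
  module ℚ+ = CommSemigroupProperties (CommutativeMonoid.commutativeSemigroup ℚ.+-0-commutativeMonoid)
  module ℚ+-group = GroupProperties ℚ.+-0-group

Invertible : ℚ → Set
Invertible x = Σ ℚ (λ y → x * y ≡ 1ℚ)

*-invertible : ∀ x y → Invertible x → Invertible y → Invertible (x * y)
*-invertible x y (x⁻¹ , xx⁻¹≡1) (y⁻¹ , yy⁻¹≡1) = x⁻¹ * y⁻¹ , (begin
  x * y * (x⁻¹ * y⁻¹)  ≡⟨ ℚ*.interchange x y x⁻¹ y⁻¹ ⟩
  x * x⁻¹ * (y * y⁻¹)  ≡⟨ cong₂ _*_ xx⁻¹≡1 yy⁻¹≡1 ⟩
  1ℚ * 1ℚ              ≡⟨ ℚ.*-identityˡ 1ℚ ⟩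
  1ℚ                   ∎)

*-cancelʳ-invertible : ∀ {x y} c → Invertible c → x * c ≡ y * c → x ≡ y
*-cancelʳ-invertible {x} {y} c (c⁻¹ , cc⁻¹≡1) xc≡yc = begin
  x              ≡⟨ ℚ.*-identityʳ x ⟨
  x * 1ℚ         ≡⟨ cong (x *_) cc⁻¹≡1 ⟨
  x * (c * c⁻¹)  ≡⟨ ℚ.*-assoc x c c⁻¹ ⟨
  x * c * c⁻¹    ≡⟨ cong (_* c⁻¹) xc≡yc ⟩
  y * c * c⁻¹    ≡⟨ ℚ.*-assoc y c c⁻¹ ⟩
  y * (c * c⁻¹)  ≡⟨ cong (y *_) cc⁻¹≡1 ⟩
  y * 1ℚ         ≡⟨ ℚ.*-identityʳ y ⟩
  y              ∎

-- Expressions in n variables and k reciprocals: `rec t` stands for the inverse of the t-th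
-- denominator, a polynomial in the variables.
infixl 6 _:+_ _:-_
infixl 7 _:*_
infix  8 :-_

data Expr (n k : ℕ) : Set where
  con       : ℚ → Expr n k
  var       : Fin n → Expr n k
  rec       : Fin k → Expr n k
  _:+_ _:*_ : Expr n k → Expr n k → Expr n k
  :-_       : Expr n k → Expr n k

_:-_ : ∀ {n k} → Expr n k → Expr n k → Expr n k
e :- f = e :+ :- f

⟦_⟧ : ∀ {n k} → Expr n k → Vec ℚ n → Vec ℚ k → ℚ
⟦ con c  ⟧ ρ ι = c
⟦ var x  ⟧ ρ ι = lookup ρ x
⟦ rec t  ⟧ ρ ι = lookup ι t
⟦ e :+ f ⟧ ρ ι = ⟦ e ⟧ ρ ι + ⟦ f ⟧ ρ ι
⟦ e :* f ⟧ ρ ι = ⟦ e ⟧ ρ ι * ⟦ f ⟧ ρ ι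
⟦ :- e   ⟧ ρ ι = - ⟦ e ⟧ ρ ι

exprRawRing : ℕ → ℕ → RawRing 0ℓ 0ℓ
exprRawRing n k = record
  { Carrier = Expr n k ; _≈_ = _≡_ ; _+_ = _:+_ ; _*_ = _:*_ ; -_ = :-_ ; 0# = con 0ℚ ; 1# = con 1ℚ }

toPolynomial : ∀ {n} → Expr n 0 → Poly.Polynomial n
toPolynomial (con c)  = Poly.con c
toPolynomial (var x)  = Poly.var x
toPolynomial (e :+ f) = toPolynomial e Poly.:+ toPolynomial f
toPolynomial (e :* f) = toPolynomial e Poly.:* toPolynomial f
toPolynomial (:- e)   = Poly.:- toPolynomial e

toPolynomial-correct : ∀ {n} (e : Expr n 0) ρ → Poly.⟦ toPolynomial e ⟧ ρ ≡ ⟦ e ⟧ ρ []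
toPolynomial-correct (con c)  ρ = refl
toPolynomial-correct (var x)  ρ = refl
toPolynomial-correct (e :+ f) ρ = cong₂ _+_ (toPolynomial-correct e ρ) (toPolynomial-correct f ρ)
toPolynomial-correct (e :* f) ρ = cong₂ _*_ (toPolynomial-correct e ρ) (toPolynomial-correct f ρ)
toPolynomial-correct (:- e)   ρ = cong -_ (toPolynomial-correct e ρ)

Exponents : ℕ → Set
Exponents = Vec ℕ

zeros : ∀ {k} → Exponents k
zeros = replicate _ 0

unit : ∀ {k} → Fin k → Exponents k
unit zero    = 1 ∷ zeros
unit (suc t) = 0 ∷ unit t

≤-⊔ˡ : ∀ {k} (α β : Exponents k) → Pointwise ℕ._≤_ α (zipWith ℕ._⊔_ α β)
≤-⊔ˡ []      []      = []
≤-⊔ˡ (a ∷ α) (b ∷ β) = ℕ.m≤m⊔n a b ∷ ≤-⊔ˡ α β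

≤-⊔ʳ : ∀ {k} (α β : Exponents k) → Pointwise ℕ._≤_ β (zipWith ℕ._⊔_ α β)
≤-⊔ʳ []      []      = []
≤-⊔ʳ (a ∷ α) (b ∷ β) = ℕ.m≤n⊔m a b ∷ ≤-⊔ʳ α β

+-∸-cancel : ∀ {k} {α γ : Exponents k} → Pointwise ℕ._≤_ α γ → zipWith ℕ._+_ α (zipWith ℕ._∸_ γ α) ≡ γ
+-∸-cancel []          = refl
+-∸-cancel (a≤c ∷ α≤γ) = cong₂ _∷_ (ℕ.m+[n∸m]≡n a≤c) (+-∸-cancel α≤γ)

-- An expression e is cleared to the numerator `num e` over the monomial denominator
-- Π dₜ ^ (den e)ₜ, taking least common multiples in sums so that degrees stay small.
module ClearDenominators {n k} (ds : Vec (Expr n 0) k) where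

  _^_ : Poly.Polynomial n → ℕ → Poly.Polynomial n
  p ^ ℕ.zero = Poly.con 1ℚ
  p ^ suc e  = p Poly.:* p ^ e

  power : ∀ {j} → Vec (Expr n 0) j → Exponents j → Poly.Polynomial n
  power []        []      = Poly.con 1ℚ
  power (d ∷ ds′) (a ∷ α) = toPolynomial d ^ a Poly.:* power ds′ α

  den : Expr n k → Exponents k
  den (con c)  = zeros
  den (var x)  = zeros
  den (rec t)  = unit t
  den (e :+ f) = zipWith ℕ._⊔_ (den e) (den f)
  den (e :* f) = zipWith ℕ._+_ (den e) (den f)
  den (:- e)   = den e

  raise : Poly.Polynomial n → Exponents k → Exponents k → Poly.Polynomial n
  raise p α γ = p Poly.:* power ds (zipWith ℕ._∸_ γ α)

  num : Expr n k → Poly.Polynomial n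
  num (con c)  = Poly.con c
  num (var x)  = Poly.var x
  num (rec t)  = Poly.con 1ℚ
  num (e :+ f) = raise (num e) (den e) (den (e :+ f)) Poly.:+ raise (num f) (den f) (den (e :+ f))
  num (e :* f) = num e Poly.:* num f
  num (:- e)   = Poly.:- num e

  module _ (ρ : Vec ℚ n) where

    Π : ∀ {j} → Vec (Expr n 0) j → Exponents j → ℚ
    Π ds′ α = Poly.⟦ power ds′ α ⟧ ρ

    Reciprocals : ∀ {j} → Vec (Expr n 0) j → Vec ℚ j → Set
    Reciprocals = Pointwise (λ d i → ⟦ d ⟧ ρ [] * i ≡ 1ℚ)

    ^-+ : ∀ p a b → Poly.⟦ p ^ (a ℕ.+ b) ⟧ ρ ≡ Poly.⟦ p ^ a ⟧ ρ * Poly.⟦ p ^ b ⟧ ρ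
    ^-+ p ℕ.zero  b = sym (ℚ.*-identityˡ _)
    ^-+ p (suc a) b = trans (cong (Poly.⟦ p ⟧ ρ *_) (^-+ p a b))
                            (sym (ℚ.*-assoc (Poly.⟦ p ⟧ ρ) (Poly.⟦ p ^ a ⟧ ρ) (Poly.⟦ p ^ b ⟧ ρ)))

    ^-invertible : ∀ p → Invertible (Poly.⟦ p ⟧ ρ) → ∀ a → Invertible (Poly.⟦ p ^ a ⟧ ρ)
    ^-invertible p inv ℕ.zero  = 1ℚ , ℚ.*-identityˡ 1ℚ
    ^-invertible p inv (suc a) = *-invertible (Poly.⟦ p ⟧ ρ) (Poly.⟦ p ^ a ⟧ ρ) inv (^-invertible p inv a)

    Π-zeros : ∀ {j} (ds′ : Vec (Expr n 0) j) → Π ds′ zeros ≡ 1ℚ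
    Π-zeros []        = refl
    Π-zeros (d ∷ ds′) = trans (ℚ.*-identityˡ _) (Π-zeros ds′)

    Π-+ : ∀ {j} (ds′ : Vec (Expr n 0) j) α β → Π ds′ (zipWith ℕ._+_ α β) ≡ Π ds′ α * Π ds′ β
    Π-+ []        []      []      = sym (ℚ.*-identityˡ 1ℚ)
    Π-+ (d ∷ ds′) (a ∷ α) (b ∷ β) = trans (cong₂ _*_ (^-+ (toPolynomial d) a b) (Π-+ ds′ α β))
      (ℚ*.interchange (Poly.⟦ toPolynomial d ^ a ⟧ ρ) (Poly.⟦ toPolynomial d ^ b ⟧ ρ) (Π ds′ α) (Π ds′ β))

    Π-unit : ∀ {j} (ds′ : Vec (Expr n 0) j) ι → Reciprocals ds′ ι → ∀ t → Π ds′ (unit t) * lookup ι t ≡ 1ℚ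
    Π-unit (d ∷ ds′) (i ∷ ι) (di≡1 ∷ _) zero = begin
      D * 1ℚ * Π ds′ zeros * i  ≡⟨ cong (λ x → D * 1ℚ * x * i) (Π-zeros ds′) ⟩
      D * 1ℚ * 1ℚ * i           ≡⟨ cong (_* i) (trans (ℚ.*-identityʳ (D * 1ℚ)) (ℚ.*-identityʳ D)) ⟩
      D * i                     ≡⟨ cong (_* i) (toPolynomial-correct d ρ) ⟩
      ⟦ d ⟧ ρ [] * i            ≡⟨ di≡1 ⟩
      1ℚ                        ∎
      where D = Poly.⟦ toPolynomial d ⟧ ρ
    Π-unit (d ∷ ds′) (i ∷ ι) (_ ∷ hyps) (suc t) =
      trans (cong (_* lookup ι t) (ℚ.*-identityˡ (Π ds′ (unit t)))) (Π-unit ds′ ι hyps t)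

    Π-invertible : ∀ {j} (ds′ : Vec (Expr n 0) j) ι → Reciprocals ds′ ι → ∀ α → Invertible (Π ds′ α)
    Π-invertible []        []      []           []      = 1ℚ , ℚ.*-identityˡ 1ℚ
    Π-invertible (d ∷ ds′) (i ∷ ι) (di≡1 ∷ hyps) (a ∷ α) =
      *-invertible (Poly.⟦ toPolynomial d ^ a ⟧ ρ) (Π ds′ α)
        (^-invertible (toPolynomial d) (i , trans (cong (_* i) (toPolynomial-correct d ρ)) di≡1) a)
        (Π-invertible ds′ ι hyps α)

    Π-split : ∀ {α γ} → Pointwise ℕ._≤_ α γ → Π ds γ ≡ Π ds α * Π ds (zipWith ℕ._∸_ γ α)
    Π-split {α} {γ} α≤γ = trans (cong (Π ds) (sym (+-∸-cancel α≤γ))) (Π-+ ds α (zipWith ℕ._∸_ γ α))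

    module _ (ι : Vec ℚ k) (hyps : Reciprocals ds ι) where

      num-correct : ∀ e → Poly.⟦ num e ⟧ ρ ≡ ⟦ e ⟧ ρ ι * Π ds (den e)

      raise-correct : ∀ e {γ} → Pointwise ℕ._≤_ (den e) γ →
                      Poly.⟦ raise (num e) (den e) γ ⟧ ρ ≡ ⟦ e ⟧ ρ ι * Π ds γ
      raise-correct e {γ} α≤γ = begin
        Poly.⟦ num e ⟧ ρ * Π ds δ       ≡⟨ cong (_* Π ds δ) (num-correct e) ⟩
        ⟦ e ⟧ ρ ι * Π ds α * Π ds δ     ≡⟨ ℚ.*-assoc (⟦ e ⟧ ρ ι) (Π ds α) (Π ds δ) ⟩
        ⟦ e ⟧ ρ ι * (Π ds α * Π ds δ)   ≡⟨ cong (⟦ e ⟧ ρ ι *_) (Π-split α≤γ) ⟨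
        ⟦ e ⟧ ρ ι * Π ds γ               ∎
        where
        α = den e
        δ = zipWith ℕ._∸_ γ α

      num-correct (con c)  = sym (trans (cong (c *_) (Π-zeros ds)) (ℚ.*-identityʳ c))
      num-correct (var x)  = sym (trans (cong (lookup ρ x *_) (Π-zeros ds)) (ℚ.*-identityʳ (lookup ρ x)))
      num-correct (rec t)  = sym (trans (ℚ.*-comm (lookup ι t) (Π ds (unit t))) (Π-unit ds ι hyps t))
      num-correct (e :+ f) = trans
        (cong₂ _+_ (raise-correct e (≤-⊔ˡ (den e) (den f))) (raise-correct f (≤-⊔ʳ (den e) (den f))))
        (sym (ℚ.*-distribʳ-+ (Π ds (den (e :+ f))) (⟦ e ⟧ ρ ι) (⟦ f ⟧ ρ ι)))
      num-correct (e :* f) = begin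
        Poly.⟦ num e ⟧ ρ * Poly.⟦ num f ⟧ ρ  ≡⟨ cong₂ _*_ (num-correct e) (num-correct f) ⟩
        x * Π ds α * (y * Π ds β)            ≡⟨ ℚ*.interchange x (Π ds α) y (Π ds β) ⟩
        x * y * (Π ds α * Π ds β)            ≡⟨ cong (x * y *_) (Π-+ ds α β) ⟨
        x * y * Π ds (den (e :* f))          ∎
        where
        x = ⟦ e ⟧ ρ ι
        y = ⟦ f ⟧ ρ ι
        α = den e
        β = den f
      num-correct (:- e)   = trans (cong -_ (num-correct e)) (ℚ.neg-distribˡ-* (⟦ e ⟧ ρ ι) (Π ds (den e)))

      prove : ∀ e f → let γ = zipWith ℕ._⊔_ (den e) (den f) in
              Poly.⟦ raise (num e) (den e) γ ⟧↓ ρ ≡ Poly.⟦ raise (num f) (den f) γ ⟧↓ ρ →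
              ⟦ e ⟧ ρ ι ≡ ⟦ f ⟧ ρ ι
      prove e f nf≡ = *-cancelʳ-invertible (Π ds γ) (Π-invertible ds ι hyps γ) (begin
        ⟦ e ⟧ ρ ι * Π ds γ                  ≡⟨ raise-correct e (≤-⊔ˡ (den e) (den f)) ⟨
        Poly.⟦ raise (num e) (den e) γ ⟧ ρ  ≡⟨ Poly.prove ρ (raise (num e) (den e) γ) (raise (num f) (den f) γ) nf≡ ⟩
        Poly.⟦ raise (num f) (den f) γ ⟧ ρ  ≡⟨ raise-correct f (≤-⊔ʳ (den e) (den f)) ⟩
        ⟦ f ⟧ ρ ι * Π ds γ                  ∎)
        where γ = zipWith ℕ._⊔_ (den e) (den f)

open Shapes ℚ.+-*-rawRing id using (summand; harmonic; certificate; rhs-shape)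
module E {n k} = Shapes (exprRawRing n k) con

cong₃ : ∀ {A B C D : Set} (f : A → B → C → D) {a a′ b b′ c c′} →
        a ≡ a′ → b ≡ b′ → c ≡ c′ → f a b c ≡ f a′ b′ c′
cong₃ f refl refl refl = refl

toℚᵘ-fromℕ : ∀ n → toℚᵘ (fromℕ n) ≡ ℚᵘ.mkℚᵘ (+ n) 0
toℚᵘ-fromℕ n = cong toℚᵘ (ℚ.normalize-coprime (coprime-sym (1-coprimeTo n)))

fromℕ-+ : ∀ m n → fromℕ (m ℕ.+ n) ≡ fromℕ m + fromℕ n
fromℕ-+ m n = ℚ.toℚᵘ-injective (ℚᵘ.≃-trans (ℚᵘ.≃-reflexive left)
  (ℚᵘ.≃-sym (ℚᵘ.≃-trans (ℚ.toℚᵘ-homo-+ (fromℕ m) (fromℕ n)) (ℚᵘ.≃-reflexive right))))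
  where
  left : toℚᵘ (fromℕ (m ℕ.+ n)) ≡ ℚᵘ.mkℚᵘ (+ m ℤ.+ + n) 0
  left = trans (toℚᵘ-fromℕ (m ℕ.+ n)) (cong (λ z → ℚᵘ.mkℚᵘ z 0) (ℤ.pos-+ m n))
  right : toℚᵘ (fromℕ m) ℚᵘ.+ toℚᵘ (fromℕ n) ≡ ℚᵘ.mkℚᵘ (+ m ℤ.+ + n) 0
  right rewrite toℚᵘ-fromℕ m | toℚᵘ-fromℕ n =
    cong₂ (λ a b → ℚᵘ.mkℚᵘ (a ℤ.+ b) 0) (ℤ.*-identityʳ (+ m)) (ℤ.*-identityʳ (+ n))

fromℕ-* : ∀ m n → fromℕ (m ℕ.* n) ≡ fromℕ m * fromℕ n
fromℕ-* m n = ℚ.toℚᵘ-injective (ℚᵘ.≃-trans (ℚᵘ.≃-reflexive left)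
  (ℚᵘ.≃-sym (ℚᵘ.≃-trans (ℚ.toℚᵘ-homo-* (fromℕ m) (fromℕ n)) (ℚᵘ.≃-reflexive right))))
  where
  left : toℚᵘ (fromℕ (m ℕ.* n)) ≡ ℚᵘ.mkℚᵘ (+ m ℤ.* + n) 0
  left = trans (toℚᵘ-fromℕ (m ℕ.* n)) (cong (λ z → ℚᵘ.mkℚᵘ z 0) (ℤ.pos-* m n))
  right : toℚᵘ (fromℕ m) ℚᵘ.* toℚᵘ (fromℕ n) ≡ ℚᵘ.mkℚᵘ (+ m ℤ.* + n) 0
  right rewrite toℚᵘ-fromℕ m | toℚᵘ-fromℕ n = refl

fromℕ-suc : ∀ n → fromℕ (suc n) ≡ 1ℚ + fromℕ n
fromℕ-suc = fromℕ-+ 1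

fromℕ-∸ : ∀ {m n} → n ℕ.≤ m → fromℕ (m ∸ n) ≡ fromℕ m - fromℕ n
fromℕ-∸ {m} {n} n≤m = ℚ+-group.x≈z//y (fromℕ (m ∸ n)) (fromℕ n) (fromℕ m)
  (trans (sym (fromℕ-+ (m ∸ n) n)) (cong fromℕ (ℕ.m∸n+n≡m n≤m)))

fromℕ*inv : ∀ n → fromℕ (suc n) * inv (suc n) ≡ 1ℚ
fromℕ*inv n = ℚ.toℚᵘ-injective (ℚᵘ.≃-trans (ℚ.toℚᵘ-homo-* (fromℕ (suc n)) (inv (suc n))) eq)
  where
  eq : toℚᵘ (fromℕ (suc n)) ℚᵘ.* toℚᵘ (inv (suc n)) ℚᵘ.≃ toℚᵘ 1ℚ
  eq rewrite toℚᵘ-fromℕ (suc n) | ℚ.normalize-coprime (1-coprimeTo (suc n)) =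
    ℚᵘ.*≡* (trans (ℤ.*-identityʳ _) (trans (ℤ.*-identityʳ _)
      (sym (trans (ℤ.*-identityˡ _) (cong +_ (ℕ.*-identityˡ (suc n)))))))

reciprocal : ∀ n {k} → n ≡ suc k → ∀ {q} → fromℕ n ≡ q → q * inv n ≡ 1ℚ
reciprocal _ {k} refl refl = fromℕ*inv k

fromℕ-ratio : ∀ d a b c → suc d ℕ.* a ≡ b ℕ.* c → fromℕ a ≡ fromℕ b * fromℕ c * inv (suc d)
fromℕ-ratio d a b c eq = begin
  fromℕ a                                  ≡⟨ ℚ.*-identityʳ (fromℕ a) ⟨
  fromℕ a * 1ℚ                             ≡⟨ cong (fromℕ a *_) (fromℕ*inv d) ⟨
  fromℕ a * (fromℕ (suc d) * inv (suc d))  ≡⟨ ℚ*.x∙yz≈yx∙z (fromℕ a) (fromℕ (suc d)) (inv (suc d)) ⟩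
  fromℕ (suc d) * fromℕ a * inv (suc d)    ≡⟨ cong (_* inv (suc d)) (fromℕ-* (suc d) a) ⟨
  fromℕ (suc d ℕ.* a) * inv (suc d)        ≡⟨ cong (λ n → fromℕ n * inv (suc d)) eq ⟩
  fromℕ (b ℕ.* c) * inv (suc d)            ≡⟨ cong (_* inv (suc d)) (fromℕ-* b c) ⟩
  fromℕ b * fromℕ c * inv (suc d)          ∎

[k+1]*[n+1]C[k+1]≡[n+1]*nCk : ∀ n k → suc k ℕ.* (suc n C suc k) ≡ suc n ℕ.* (n C k)
[k+1]*[n+1]C[k+1]≡[n+1]*nCk n ℕ.zero =
  trans (ℕ.*-identityˡ (suc n C 1)) (trans (nC1≡n (suc n)) (sym (ℕ.*-identityʳ (suc n))))
[k+1]*[n+1]C[k+1]≡[n+1]*nCk ℕ.zero (suc k) = begin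
  (2 ℕ.+ k) ℕ.* (1 C (2 ℕ.+ k))  ≡⟨ cong ((2 ℕ.+ k) ℕ.*_) (k>n⇒nCk≡0 {1} {2 ℕ.+ k} (ℕ.s≤s (ℕ.s≤s ℕ.z≤n))) ⟩
  (2 ℕ.+ k) ℕ.* 0                ≡⟨ ℕ.*-zeroʳ (2 ℕ.+ k) ⟩
  0                              ≡⟨ cong (1 ℕ.*_) (k>n⇒nCk≡0 {0} {suc k} (ℕ.s≤s ℕ.z≤n)) ⟨
  1 ℕ.* (0 C suc k)              ∎
[k+1]*[n+1]C[k+1]≡[n+1]*nCk (suc n) (suc k) = begin
  (2 ℕ.+ k) ℕ.* ((2 ℕ.+ n) C (2 ℕ.+ k))
    ≡⟨ cong ((2 ℕ.+ k) ℕ.*_) (nCk+nC[k+1]≡[n+1]C[k+1] (suc n) (suc k)) ⟨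
  (2 ℕ.+ k) ℕ.* (a ℕ.+ b)
    ≡⟨ split k a b ⟩
  (1 ℕ.+ k) ℕ.* a ℕ.+ a ℕ.+ (2 ℕ.+ k) ℕ.* b
    ≡⟨ cong₂ (λ x y → x ℕ.+ a ℕ.+ y) ([k+1]*[n+1]C[k+1]≡[n+1]*nCk n k) ([k+1]*[n+1]C[k+1]≡[n+1]*nCk n (suc k)) ⟩
  (1 ℕ.+ n) ℕ.* c ℕ.+ a ℕ.+ (1 ℕ.+ n) ℕ.* d
    ≡⟨ regroup n a c d ⟩
  (1 ℕ.+ n) ℕ.* (c ℕ.+ d) ℕ.+ a
    ≡⟨ cong (λ x → (1 ℕ.+ n) ℕ.* x ℕ.+ a) (nCk+nC[k+1]≡[n+1]C[k+1] n k) ⟩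
  (1 ℕ.+ n) ℕ.* a ℕ.+ a
    ≡⟨ merge n a ⟩
  (2 ℕ.+ n) ℕ.* a
    ∎
  where
  a = suc n C suc k
  b = suc n C suc (suc k)
  c = n C k
  d = n C suc k
  split : ∀ k a b → (2 ℕ.+ k) ℕ.* (a ℕ.+ b) ≡ (1 ℕ.+ k) ℕ.* a ℕ.+ a ℕ.+ (2 ℕ.+ k) ℕ.* b
  split = solve-∀
  regroup : ∀ n a c d → (1 ℕ.+ n) ℕ.* c ℕ.+ a ℕ.+ (1 ℕ.+ n) ℕ.* d ≡ (1 ℕ.+ n) ℕ.* (c ℕ.+ d) ℕ.+ a
  regroup = solve-∀
  merge : ∀ n a → (1 ℕ.+ n) ℕ.* a ℕ.+ a ≡ (2 ℕ.+ n) ℕ.* a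
  merge = solve-∀

[k+1]*nC[k+1]≡[n∸k]*nCk : ∀ n k → suc k ℕ.* (n C suc k) ≡ (n ∸ k) ℕ.* (n C k)
[k+1]*nC[k+1]≡[n∸k]*nCk n k = begin
  suc k ℕ.* (n C suc k)                                          ≡⟨ ℕ.m+n∸m≡n (suc k ℕ.* (n C k)) _ ⟨
  suc k ℕ.* (n C k) ℕ.+ suc k ℕ.* (n C suc k) ∸ suc k ℕ.* (n C k) ≡⟨ cong (_∸ suc k ℕ.* (n C k)) pascal ⟩
  suc n ℕ.* (n C k) ∸ suc k ℕ.* (n C k)                          ≡⟨ ℕ.*-distribʳ-∸ (n C k) (suc n) (suc k) ⟨
  (n ∸ k) ℕ.* (n C k)                                            ∎
  where
  pascal : suc k ℕ.* (n C k) ℕ.+ suc k ℕ.* (n C suc k) ≡ suc n ℕ.* (n C k)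
  pascal = trans (sym (ℕ.*-distribˡ-+ (suc k) (n C k) (n C suc k)))
                 (trans (cong (suc k ℕ.*_) (nCk+nC[k+1]≡[n+1]C[k+1] n k)) ([k+1]*[n+1]C[k+1]≡[n+1]*nCk n k))

[n+1∸k]*[n+1]Ck≡[n+1]*nCk : ∀ n k → (suc n ∸ k) ℕ.* (suc n C k) ≡ suc n ℕ.* (n C k)
[n+1∸k]*[n+1]Ck≡[n+1]*nCk n ℕ.zero  = refl
[n+1∸k]*[n+1]Ck≡[n+1]*nCk n (suc k) = ℕ.*-cancelˡ-≡ _ _ (suc k) (begin
  suc k ℕ.* ((n ∸ k) ℕ.* (suc n C suc k))  ≡⟨ ℕ*.x∙yz≈y∙xz (suc k) (n ∸ k) _ ⟩
  (n ∸ k) ℕ.* (suc k ℕ.* (suc n C suc k))  ≡⟨ cong ((n ∸ k) ℕ.*_) ([k+1]*[n+1]C[k+1]≡[n+1]*nCk n k) ⟩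
  (n ∸ k) ℕ.* (suc n ℕ.* (n C k))          ≡⟨ ℕ*.x∙yz≈y∙xz (n ∸ k) (suc n) _ ⟩
  suc n ℕ.* ((n ∸ k) ℕ.* (n C k))          ≡⟨ cong (suc n ℕ.*_) ([k+1]*nC[k+1]≡[n∸k]*nCk n k) ⟨
  suc n ℕ.* (suc k ℕ.* (n C suc k))        ≡⟨ ℕ*.x∙yz≈y∙xz (suc n) (suc k) _ ⟩
  suc k ℕ.* (suc n ℕ.* (n C suc k))        ∎)
  where module ℕ* = CommSemigroupProperties ℕ.*-commutativeSemigroup

fromℕ-[n+1]C[k+1] : ∀ n k → fromℕ (suc n C suc k) ≡ fromℕ (suc n) * fromℕ (n C k) * inv (suc k)
fromℕ-[n+1]C[k+1] n k = fromℕ-ratio k _ (suc n) (n C k) ([k+1]*[n+1]C[k+1]≡[n+1]*nCk n k)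

fromℕ-nC[k+1] : ∀ n k → fromℕ (n C suc k) ≡ fromℕ (n ∸ k) * fromℕ (n C k) * inv (suc k)
fromℕ-nC[k+1] n k = fromℕ-ratio k _ (n ∸ k) (n C k) ([k+1]*nC[k+1]≡[n∸k]*nCk n k)

fromℕ-[n+1]Ck : ∀ {n k} → k ℕ.≤ n → fromℕ (suc n C k) ≡ fromℕ (suc n) * fromℕ (n C k) * inv (suc n ∸ k)
fromℕ-[n+1]Ck {n} {k} k≤n = begin
  fromℕ (suc n C k)                                  ≡⟨ fromℕ-ratio (n ∸ k) (suc n C k) (suc n) (n C k) scaled ⟩
  fromℕ (suc n) * fromℕ (n C k) * inv (suc (n ∸ k))  ≡⟨ cong (λ d → fromℕ (suc n) * fromℕ (n C k) * inv d) suc-∸ ⟨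
  fromℕ (suc n) * fromℕ (n C k) * inv (suc n ∸ k)    ∎
  where
  suc-∸ : suc n ∸ k ≡ suc (n ∸ k)
  suc-∸ = ℕ.+-∸-assoc 1 k≤n
  scaled : suc (n ∸ k) ℕ.* (suc n C k) ≡ suc n ℕ.* (n C k)
  scaled = trans (cong (ℕ._* (suc n C k)) (sym suc-∸)) ([n+1∸k]*[n+1]Ck≡[n+1]*nCk n k)

H-pred : ∀ {n k} → n ≡ suc k → H n ≡ H k + inv n
H-pred refl = refl

Σ0to-linear : ∀ n (f g : ℕ → ℚ) a b → Σ0to n (λ j → a * f j + b * g j) ≡ a * Σ0to n f + b * Σ0to n g
Σ0to-linear ℕ.zero    f g a b = refl
Σ0to-linear (suc n) f g a b = begin
  Σ0to n (λ j → a * f j + b * g j) + (a * fₙ + b * gₙ)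
    ≡⟨ cong (_+ (a * fₙ + b * gₙ)) (Σ0to-linear n f g a b) ⟩
  a * F + b * G + (a * fₙ + b * gₙ)
    ≡⟨ ℚ+.interchange (a * F) (b * G) (a * fₙ) (b * gₙ) ⟩
  a * F + a * fₙ + (b * G + b * gₙ)
    ≡⟨ cong₂ _+_ (ℚ.*-distribˡ-+ a F fₙ) (ℚ.*-distribˡ-+ b G gₙ) ⟨
  a * (F + fₙ) + b * (G + gₙ)
    ∎
  where
  F = Σ0to n f
  G = Σ0to n g
  fₙ = f (suc n)
  gₙ = g (suc n)

Σ0to-telescope : ∀ n (f F : ℕ → ℚ) → (∀ j → j ℕ.≤ n → f j + F j ≡ F (suc j)) → Σ0to n f + F 0 ≡ F (suc n)
Σ0to-telescope ℕ.zero    f F step = step 0 ℕ.z≤n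
Σ0to-telescope (suc n) f F step = begin
  Σ0to n f + f (suc n) + F 0  ≡⟨ ℚ+.xy∙z≈xz∙y (Σ0to n f) (f (suc n)) (F 0) ⟩
  Σ0to n f + F 0 + f (suc n)  ≡⟨ cong (_+ f (suc n)) (Σ0to-telescope n f F (λ j → step j ∘ ℕ.m≤n⇒m≤1+n)) ⟩
  F (suc n) + f (suc n)       ≡⟨ ℚ.+-comm (F (suc n)) (f (suc n)) ⟩
  f (suc n) + F (suc n)       ≡⟨ step (suc n) ℕ.≤-refl ⟩
  F (suc (suc n))             ∎

first-order-recurrence-unique : ∀ (c d w x y : ℕ → ℚ) → (∀ n → Invertible (c n)) →
  (∀ n → c n * x (suc n) + d n * x n ≡ w n) → (∀ n → c n * y (suc n) + d n * y n ≡ w n) →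
  x 0 ≡ y 0 → ∀ n → x n ≡ y n
first-order-recurrence-unique c d w x y c-invertible x-solves y-solves x₀≡y₀ = agree
  where
  agree : ∀ n → x n ≡ y n
  agree ℕ.zero    = x₀≡y₀
  agree (suc n) = *-cancelʳ-invertible (c n) (c-invertible n)
    (trans (ℚ.*-comm (x (suc n)) (c n))
      (trans (ℚ+-group.∙-cancelʳ (d n * y n) _ _ same-rest) (ℚ.*-comm (c n) (y (suc n)))))
    where
    same-rest : c n * x (suc n) + d n * y n ≡ c n * y (suc n) + d n * y n
    same-rest = trans (cong (λ z → c n * x (suc n) + d n * z) (sym (agree n))) (trans (x-solves n) (sym (y-solves n)))

binomialWeight : ℕ → ℕ → ℚ
binomialWeight m j = fromℕ ((m ℕ.+ j) C j) * fromℕ (m C j) * sgn j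

harmonicPart : ℕ → ℕ → ℚ
harmonicPart m j = harmonic (H (m ℕ.+ j)) (H (m ∸ j)) (H j)

term : ℕ → ℕ → ℚ
term m j = summand (binomialWeight m j) (fromℕ j) (harmonicPart m j)

certificateAt : ℕ → ℕ → ℚ
certificateAt m j = certificate (binomialWeight m j) (inv (suc m ∸ j)) (fromℕ j) (fromℕ m) (harmonicPart m j)

lhs : ℕ → ℚ
lhs n = Σ0to n (term n)

central : ℕ → ℚ
central n = fromℕ ((2 ℕ.* n) C n)

rhs : ℕ → ℚ
rhs n = fromℕ (1 ℕ.+ 2 ℕ.* n) * central n * sgn n
        - ((+ 3) / 2) * fromℕ n * fromℕ (1 ℕ.+ n) * sgn n * Σ1to n (λ i → central i * inv i)

recurrence : (ℕ → ℚ) → ℕ → ℚ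
recurrence x m = fromℕ m * x (suc m) + fromℕ (m ℕ.+ 2) * x m

inhomogeneity : ℕ → ℚ
inhomogeneity m = central (suc m) * sgn m * (fromℕ 3 * fromℕ m + fromℕ 2) * inv 2

certificate-at-zero : ∀ c d m L → certificate c d 0ℚ m L ≡ 0ℚ
certificate-at-zero c d m L =
  ClearDenominators.prove [] (c ∷ d ∷ m ∷ L ∷ []) [] [] (E.certificate c′ d′ (con 0ℚ) m′ L′) (con 0ℚ) refl
  where
  c′ d′ m′ L′ : Expr 4 0
  c′ = var (# 0)
  d′ = var (# 1)
  m′ = var (# 2)
  L′ = var (# 3)

wz-step-identity : ∀ x y σ J M h₊ h₋ h ip iq ir is i₁ →
  (1ℚ + M - J) * ip ≡ 1ℚ → (M - J) * iq ≡ 1ℚ → (1ℚ + J) * ir ≡ 1ℚ → (1ℚ + (M + J)) * is ≡ 1ℚ →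
  (1ℚ + M) * i₁ ≡ 1ℚ →
  let s = 1ℚ + (M + J)
      L = harmonic h₊ (h₋ + iq) h in
  M * summand (s * x * i₁ * ((1ℚ + M) * y * ip) * σ) J (harmonic (h₊ + is) (h₋ + iq + ip) h)
    + (M + fromℕ 2) * summand (x * y * σ) J L + certificate (x * y * σ) ip J M L
  ≡ certificate (s * x * ir * ((M - J) * y * ir) * (- σ)) iq (1ℚ + J) M (harmonic (h₊ + is) h₋ (h + ir))
wz-step-identity x y σ J M h₊ h₋ h ip iq ir is i₁ hp hq hr hs h₁ =
  ClearDenominators.prove ds (x ∷ y ∷ σ ∷ J ∷ M ∷ h₊ ∷ h₋ ∷ h ∷ []) (ip ∷ iq ∷ ir ∷ is ∷ i₁ ∷ [])
    (hp ∷ hq ∷ hr ∷ hs ∷ h₁ ∷ [])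
    (M′ :* E.summand (s′ :* x′ :* i₁′ :* ((one :+ M′) :* y′ :* ip′) :* σ′) J′
                     (E.harmonic (h₊′ :+ is′) (h₋′ :+ iq′ :+ ip′) h′)
      :+ (M′ :+ con (fromℕ 2)) :* E.summand (x′ :* y′ :* σ′) J′ L′
      :+ E.certificate (x′ :* y′ :* σ′) ip′ J′ M′ L′)
    (E.certificate (s′ :* x′ :* ir′ :* ((M′ :- J′) :* y′ :* ir′) :* (:- σ′)) iq′ (one :+ J′) M′
                   (E.harmonic (h₊′ :+ is′) h₋′ (h′ :+ ir′)))
    refl
  where
  one x′ y′ σ′ J′ M′ h₊′ h₋′ h′ s′ : ∀ {k} → Expr 8 k
  one = con 1ℚ
  x′  = var (# 0)
  y′  = var (# 1)
  σ′  = var (# 2)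
  J′  = var (# 3)
  M′  = var (# 4)
  h₊′ = var (# 5)
  h₋′ = var (# 6)
  h′  = var (# 7)
  s′  = one :+ (M′ :+ J′)
  ip′ iq′ ir′ is′ i₁′ L′ : Expr 8 5
  ip′ = rec (# 0)
  iq′ = rec (# 1)
  ir′ = rec (# 2)
  is′ = rec (# 3)
  i₁′ = rec (# 4)
  L′  = E.harmonic h₊′ (h₋′ :+ iq′) h′
  ds : Vec (Expr 8 0) 5
  ds = (one :+ M′ :- J′) ∷ (M′ :- J′) ∷ (one :+ J′) ∷ s′ ∷ (one :+ M′) ∷ []

boundary-identity : ∀ c σ M h₂ h i₁ i₂ i₃ →
  (1ℚ + M) * i₁ ≡ 1ℚ → (1ℚ + (M + M)) * i₂ ≡ 1ℚ → (1ℚ + (1ℚ + (M + M))) * i₃ ≡ 1ℚ →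
  let c₁ = (1ℚ + (M + M)) * c * i₁
      c₂ = (1ℚ + (1ℚ + (M + M))) * c₁ * i₁
      L  = harmonic h₂ 0ℚ h in
  certificate (c * 1ℚ * σ) 1ℚ M M L
    + (M * summand (c₁ * ((1ℚ + M) * 1ℚ * 1ℚ) * σ) M (harmonic (h₂ + i₂) 1ℚ h)
       + (M + fromℕ 2) * summand (c * 1ℚ * σ) M L)
    + M * summand (c₂ * 1ℚ * (- σ)) (1ℚ + M) (harmonic (h₂ + i₂ + i₃) 0ℚ (h + i₁))
  ≡ c₂ * σ * (fromℕ 3 * M + fromℕ 2) * inv 2
boundary-identity c σ M h₂ h i₁ i₂ i₃ h₁ h₂⁻¹ h₃ =
  ClearDenominators.prove ds (c ∷ σ ∷ M ∷ h₂ ∷ h ∷ []) (i₁ ∷ i₂ ∷ i₃ ∷ []) (h₁ ∷ h₂⁻¹ ∷ h₃ ∷ [])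
    (E.certificate (c′ :* one :* σ′) one M′ M′ L′
      :+ (M′ :* E.summand (c₁ :* ((one :+ M′) :* one :* one) :* σ′) M′ (E.harmonic (h₂′ :+ i₂′) one h′)
          :+ (M′ :+ con (fromℕ 2)) :* E.summand (c′ :* one :* σ′) M′ L′)
      :+ M′ :* E.summand (c₂ :* one :* (:- σ′)) (one :+ M′)
                         (E.harmonic (h₂′ :+ i₂′ :+ i₃′) zero′ (h′ :+ i₁′)))
    (c₂ :* σ′ :* (con (fromℕ 3) :* M′ :+ con (fromℕ 2)) :* con (inv 2))
    refl
  where
  one zero′ c′ σ′ M′ h₂′ h′ L′ : ∀ {k} → Expr 5 k
  one   = con 1ℚ
  zero′ = con 0ℚ
  c′    = var (# 0)
  σ′    = var (# 1)
  M′    = var (# 2)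
  h₂′   = var (# 3)
  h′    = var (# 4)
  L′    = E.harmonic h₂′ zero′ h′
  i₁′ i₂′ i₃′ c₁ c₂ : Expr 5 3
  i₁′ = rec (# 0)
  i₂′ = rec (# 1)
  i₃′ = rec (# 2)
  c₁  = (one :+ (M′ :+ M′)) :* c′ :* i₁′
  c₂  = (one :+ (one :+ (M′ :+ M′))) :* c₁ :* i₁′
  ds : Vec (Expr 5 0) 3
  ds = (one :+ M′) ∷ (one :+ (M′ :+ M′)) ∷ (one :+ (one :+ (M′ :+ M′))) ∷ []

rhs-recurrence-identity : ∀ c σ M s i₁ → (1ℚ + M) * i₁ ≡ 1ℚ →
  let c′ = (1ℚ + (1ℚ + (M + M))) * ((1ℚ + (M + M)) * c * i₁) * i₁ in
  M * rhs-shape (1ℚ + M) c′ (- σ) (s + c′ * i₁) + (M + fromℕ 2) * rhs-shape M c σ s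
  ≡ c′ * σ * (fromℕ 3 * M + fromℕ 2) * inv 2
rhs-recurrence-identity c σ M s i₁ h₁ =
  ClearDenominators.prove ds (c ∷ σ ∷ M ∷ s ∷ []) (i₁ ∷ []) (h₁ ∷ [])
    (M′ :* E.rhs-shape (one :+ M′) c″ (:- σ′) (s′ :+ c″ :* i₁′)
      :+ (M′ :+ con (fromℕ 2)) :* E.rhs-shape M′ c′ σ′ s′)
    (c″ :* σ′ :* (con (fromℕ 3) :* M′ :+ con (fromℕ 2)) :* con (inv 2))
    refl
  where
  one c′ σ′ M′ s′ : ∀ {k} → Expr 4 k
  one = con 1ℚ
  c′  = var (# 0)
  σ′  = var (# 1)
  M′  = var (# 2)
  s′  = var (# 3)
  i₁′ c″ : Expr 4 1
  i₁′ = rec (# 0)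
  c″  = (one :+ (one :+ (M′ :+ M′))) :* ((one :+ (M′ :+ M′)) :* c′ :* i₁′) :* i₁′
  ds : Vec (Expr 4 0) 1
  ds = (one :+ M′) ∷ []

fromℕ-suc-+ : ∀ m n → fromℕ (suc (m ℕ.+ n)) ≡ 1ℚ + (fromℕ m + fromℕ n)
fromℕ-suc-+ m n = trans (fromℕ-suc (m ℕ.+ n)) (cong (λ z → 1ℚ + z) (fromℕ-+ m n))

central≡fromℕ[n+n]Cn : ∀ n → central n ≡ fromℕ ((n ℕ.+ n) C n)
central≡fromℕ[n+n]Cn n = cong (λ k → fromℕ ((n ℕ.+ k) C n)) (ℕ.+-identityʳ n)

binomialWeight-sucˡ : ∀ {m j} → j ℕ.≤ m →
  binomialWeight (suc m) j ≡ (1ℚ + (fromℕ m + fromℕ j)) * fromℕ ((m ℕ.+ j) C j) * inv (suc m)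
                             * ((1ℚ + fromℕ m) * fromℕ (m C j) * inv (suc m ∸ j)) * sgn j
binomialWeight-sucˡ {m} {j} j≤m = cong₂ (λ a b → a * b * sgn j) first second
  where
  first : fromℕ (suc (m ℕ.+ j) C j) ≡ (1ℚ + (fromℕ m + fromℕ j)) * fromℕ ((m ℕ.+ j) C j) * inv (suc m)
  first = trans (fromℕ-[n+1]Ck (ℕ.m≤n+m j m))
                (cong₂ (λ a d → a * fromℕ ((m ℕ.+ j) C j) * inv d) (fromℕ-suc-+ m j) (ℕ.m+n∸n≡m (suc m) j))
  second : fromℕ (suc m C j) ≡ (1ℚ + fromℕ m) * fromℕ (m C j) * inv (suc m ∸ j)
  second = trans (fromℕ-[n+1]Ck j≤m) (cong (λ a → a * fromℕ (m C j) * inv (suc m ∸ j)) (fromℕ-suc m))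

binomialWeight-sucʳ : ∀ {m j} → j ℕ.≤ m →
  binomialWeight m (suc j) ≡ (1ℚ + (fromℕ m + fromℕ j)) * fromℕ ((m ℕ.+ j) C j) * inv (suc j)
                             * ((fromℕ m - fromℕ j) * fromℕ (m C j) * inv (suc j)) * (- sgn j)
binomialWeight-sucʳ {m} {j} j≤m = cong₂ (λ a b → a * b * (- sgn j)) first second
  where
  first : fromℕ ((m ℕ.+ suc j) C suc j) ≡ (1ℚ + (fromℕ m + fromℕ j)) * fromℕ ((m ℕ.+ j) C j) * inv (suc j)
  first = trans (cong (λ n → fromℕ (n C suc j)) (ℕ.+-suc m j))
                (trans (fromℕ-[n+1]C[k+1] (m ℕ.+ j) j)
                       (cong (λ a → a * fromℕ ((m ℕ.+ j) C j) * inv (suc j)) (fromℕ-suc-+ m j)))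
  second : fromℕ (m C suc j) ≡ (fromℕ m - fromℕ j) * fromℕ (m C j) * inv (suc j)
  second = trans (fromℕ-nC[k+1] m j) (cong (λ a → a * fromℕ (m C j) * inv (suc j)) (fromℕ-∸ j≤m))

harmonicPart-sucˡ : ∀ {m j} → j ℕ.≤ m →
  harmonicPart (suc m) j ≡ harmonic (H (m ℕ.+ j) + inv (suc (m ℕ.+ j))) (H (m ∸ j) + inv (suc m ∸ j)) (H j)
harmonicPart-sucˡ {m} {j} j≤m =
  cong (λ h₋ → harmonic (H (m ℕ.+ j) + inv (suc (m ℕ.+ j))) h₋ (H j)) (H-pred (ℕ.+-∸-assoc 1 j≤m))

harmonicPart-sucʳ : ∀ m j →
  harmonicPart m (suc j) ≡ harmonic (H (m ℕ.+ j) + inv (suc (m ℕ.+ j))) (H (m ∸ suc j)) (H j + inv (suc j))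
harmonicPart-sucʳ m j = cong (λ n → harmonic (H n) (H (m ∸ suc j)) (H (suc j))) (ℕ.+-suc m j)

wz-step : ∀ {m j} → j ℕ.< m →
  fromℕ m * term (suc m) j + fromℕ (m ℕ.+ 2) * term m j + certificateAt m j ≡ certificateAt m (suc j)
wz-step {m} {j} j<m = begin
  M * term (suc m) j + fromℕ (m ℕ.+ 2) * term m j + certificateAt m j
    ≡⟨ cong₂ _+_ (cong₂ _+_ (cong (M *_) term-sucˡ) (cong₂ _*_ (fromℕ-+ m 2) term-here)) certificate-here ⟩
  M * summand (s * x * i₁ * ((1ℚ + M) * y * ip) * σ) J L₁
    + (M + fromℕ 2) * summand (x * y * σ) J L + certificate (x * y * σ) ip J M L
    ≡⟨ wz-step-identity x y σ J M h₊ h₋ h ip iq ir is i₁ p·ip≡1 q·iq≡1 r·ir≡1 s·is≡1 m₁·i₁≡1 ⟩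
  certificate (s * x * ir * ((M - J) * y * ir) * (- σ)) iq (1ℚ + J) M L₂
    ≡⟨ cong₃ (λ w J L → certificate w iq J M L) (binomialWeight-sucʳ j≤m) (fromℕ-suc j) (harmonicPart-sucʳ m j) ⟨
  certificateAt m (suc j) ∎
  where
  j≤m = ℕ.<⇒≤ j<m
  M = fromℕ m
  J = fromℕ j
  s = 1ℚ + (M + J)
  x = fromℕ ((m ℕ.+ j) C j)
  y = fromℕ (m C j)
  σ = sgn j
  h₊ = H (m ℕ.+ j)
  h₋ = H (m ∸ suc j)
  h = H j
  ip = inv (suc m ∸ j)
  iq = inv (m ∸ j)
  ir = inv (suc j)
  is = inv (suc (m ℕ.+ j))
  i₁ = inv (suc m)
  L = harmonic h₊ (h₋ + iq) h
  L₁ = harmonic (h₊ + is) (h₋ + iq + ip) h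
  L₂ = harmonic (h₊ + is) h₋ (h + ir)
  H[m∸j] : H (m ∸ j) ≡ h₋ + iq
  H[m∸j] = H-pred (ℕ.+-∸-assoc 1 j<m)
  term-sucˡ : term (suc m) j ≡ summand (s * x * i₁ * ((1ℚ + M) * y * ip) * σ) J L₁
  term-sucˡ = cong₂ (λ c L → summand c J L) (binomialWeight-sucˡ j≤m)
    (trans (harmonicPart-sucˡ j≤m) (cong (λ z → harmonic (h₊ + is) (z + ip) h) H[m∸j]))
  term-here : term m j ≡ summand (x * y * σ) J L
  term-here = cong (λ z → summand (x * y * σ) J (harmonic h₊ z h)) H[m∸j]
  certificate-here : certificateAt m j ≡ certificate (x * y * σ) ip J M L
  certificate-here = cong (λ z → certificate (x * y * σ) ip J M (harmonic h₊ z h)) H[m∸j]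
  p·ip≡1 : (1ℚ + M - J) * ip ≡ 1ℚ
  p·ip≡1 = reciprocal (suc m ∸ j) (ℕ.+-∸-assoc 1 j≤m)
    (trans (fromℕ-∸ (ℕ.m≤n⇒m≤1+n j≤m)) (cong (_- J) (fromℕ-suc m)))
  q·iq≡1 : (M - J) * iq ≡ 1ℚ
  q·iq≡1 = reciprocal (m ∸ j) (ℕ.+-∸-assoc 1 j<m) (fromℕ-∸ j≤m)
  r·ir≡1 : (1ℚ + J) * ir ≡ 1ℚ
  r·ir≡1 = reciprocal (suc j) refl (fromℕ-suc j)
  s·is≡1 : s * is ≡ 1ℚ
  s·is≡1 = reciprocal (suc (m ℕ.+ j)) refl (fromℕ-suc-+ m j)
  m₁·i₁≡1 : (1ℚ + M) * i₁ ≡ 1ℚ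
  m₁·i₁≡1 = reciprocal (suc m) refl (fromℕ-suc m)

fromℕ-2+[m+m] : ∀ m → fromℕ (suc (suc (m ℕ.+ m))) ≡ 1ℚ + (1ℚ + (fromℕ m + fromℕ m))
fromℕ-2+[m+m] m = trans (fromℕ-suc (suc (m ℕ.+ m))) (cong (λ z → 1ℚ + z) (fromℕ-suc-+ m m))

central-suc : ∀ m → central (suc m)
  ≡ (1ℚ + (1ℚ + (fromℕ m + fromℕ m))) * ((1ℚ + (fromℕ m + fromℕ m)) * central m * inv (suc m)) * inv (suc m)
central-suc m = begin
  central (suc m)
    ≡⟨ central≡fromℕ[n+n]Cn (suc m) ⟩
  fromℕ (suc (m ℕ.+ suc m) C suc m)
    ≡⟨ cong (λ n → fromℕ (suc n C suc m)) (ℕ.+-suc m m) ⟩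
  fromℕ (suc (suc (m ℕ.+ m)) C suc m)
    ≡⟨ fromℕ-[n+1]C[k+1] (suc (m ℕ.+ m)) m ⟩
  fromℕ (suc (suc (m ℕ.+ m))) * fromℕ (suc (m ℕ.+ m) C m) * i₁
    ≡⟨ cong₂ (λ a b → a * b * i₁) (fromℕ-2+[m+m] m) inner ⟩
  (1ℚ + (1ℚ + (M + M))) * ((1ℚ + (M + M)) * central m * i₁) * i₁
    ∎
  where
  M = fromℕ m
  i₁ = inv (suc m)
  inner : fromℕ (suc (m ℕ.+ m) C m) ≡ (1ℚ + (M + M)) * central m * i₁
  inner = trans (fromℕ-[n+1]Ck (ℕ.m≤n+m m m))
    (cong₃ (λ a b d → a * b * inv d) (fromℕ-suc-+ m m) (sym (central≡fromℕ[n+n]Cn m)) (ℕ.m+n∸n≡m (suc m) m))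

binomialWeight-diagonal : ∀ m → binomialWeight m m ≡ central m * 1ℚ * sgn m
binomialWeight-diagonal m = cong₂ (λ a b → a * b * sgn m) (sym (central≡fromℕ[n+n]Cn m)) (cong fromℕ (nCn≡1 m))

harmonicPart-diagonal : ∀ m → harmonicPart m m ≡ harmonic (H (m ℕ.+ m)) 0ℚ (H m)
harmonicPart-diagonal m = cong (λ n → harmonic (H (m ℕ.+ m)) (H n) (H m)) (ℕ.n∸n≡0 m)

boundary : ∀ m →
  certificateAt m m + (fromℕ m * term (suc m) m + fromℕ (m ℕ.+ 2) * term m m) + fromℕ m * term (suc m) (suc m)
  ≡ inhomogeneity m
boundary m = begin
  certificateAt m m + (M * term (suc m) m + fromℕ (m ℕ.+ 2) * term m m) + M * term (suc m) (suc m)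
    ≡⟨ cong₂ _+_ (cong₂ _+_ certificate-diagonal
                             (cong₂ _+_ (cong (M *_) term-sucˡ) (cong₂ _*_ (fromℕ-+ m 2) term-diagonal)))
                 (cong (M *_) term-suc-suc) ⟩
  certificate (c * 1ℚ * σ) 1ℚ M M L
    + (M * summand (c₁ * ((1ℚ + M) * 1ℚ * 1ℚ) * σ) M L₁ + (M + fromℕ 2) * summand (c * 1ℚ * σ) M L)
    + M * summand (c₂ * 1ℚ * (- σ)) (1ℚ + M) L₂
    ≡⟨ boundary-identity c σ M h₂ h i₁ i₂ i₃ (reciprocal (suc m) refl (fromℕ-suc m))
         (reciprocal (suc (m ℕ.+ m)) refl (fromℕ-suc-+ m m)) (reciprocal (suc (suc (m ℕ.+ m))) refl (fromℕ-2+[m+m] m)) ⟩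
  c₂ * σ * (fromℕ 3 * M + fromℕ 2) * inv 2
    ≡⟨ cong (λ z → z * σ * (fromℕ 3 * M + fromℕ 2) * inv 2) (central-suc m) ⟨
  inhomogeneity m ∎
  where
  M = fromℕ m
  c = central m
  σ = sgn m
  h₂ = H (m ℕ.+ m)
  h = H m
  i₁ = inv (suc m)
  i₂ = inv (suc (m ℕ.+ m))
  i₃ = inv (suc (suc (m ℕ.+ m)))
  c₁ = (1ℚ + (M + M)) * c * i₁
  c₂ = (1ℚ + (1ℚ + (M + M))) * c₁ * i₁
  L = harmonic h₂ 0ℚ h
  L₁ = harmonic (h₂ + i₂) 1ℚ h
  L₂ = harmonic (h₂ + i₂ + i₃) 0ℚ (h + i₁)
  [m+1]∸m : suc m ∸ m ≡ 1
  [m+1]∸m = ℕ.m+n∸n≡m 1 m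
  certificate-diagonal : certificateAt m m ≡ certificate (c * 1ℚ * σ) 1ℚ M M L
  certificate-diagonal = cong₃ (λ w d L → certificate w (inv d) M M L)
    (binomialWeight-diagonal m) [m+1]∸m (harmonicPart-diagonal m)
  term-diagonal : term m m ≡ summand (c * 1ℚ * σ) M L
  term-diagonal = cong₂ (λ w L → summand w M L) (binomialWeight-diagonal m) (harmonicPart-diagonal m)
  term-sucˡ : term (suc m) m ≡ summand (c₁ * ((1ℚ + M) * 1ℚ * 1ℚ) * σ) M L₁
  term-sucˡ = cong₂ (λ w L → summand w M L)
    (trans (binomialWeight-sucˡ {m} {m} ℕ.≤-refl)
           (cong₃ (λ a b d → (1ℚ + (M + M)) * a * i₁ * ((1ℚ + M) * b * inv d) * σ)
                  (sym (central≡fromℕ[n+n]Cn m)) (cong fromℕ (nCn≡1 m)) [m+1]∸m))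
    (cong (λ n → harmonic (h₂ + i₂) (H n) h) [m+1]∸m)
  term-suc-suc : term (suc m) (suc m) ≡ summand (c₂ * 1ℚ * (- σ)) (1ℚ + M) L₂
  term-suc-suc = cong₃ (λ w J L → summand w J L)
    (trans (binomialWeight-diagonal (suc m)) (cong (λ z → z * 1ℚ * (- σ)) (central-suc m)))
    (fromℕ-suc m)
    (trans (harmonicPart-diagonal (suc m)) (cong (λ n → harmonic (H (suc n)) 0ℚ (h + i₁)) (ℕ.+-suc m m)))

rhs≡rhs-shape : ∀ n → rhs n ≡ rhs-shape (fromℕ n) (central n) (sgn n) (Σ1to n (λ i → central i * inv i))
rhs≡rhs-shape n =
  cong₂ (λ a b → a * central n * sgn n - ((+ 3) / 2) * fromℕ n * b * sgn n * Σ1to n (λ i → central i * inv i))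
  (trans (fromℕ-suc (2 ℕ.* n)) (cong (λ z → 1ℚ + z) (fromℕ-* 2 n))) (fromℕ-suc n)

rhs-recurrence : ∀ m → recurrence rhs m ≡ inhomogeneity m
rhs-recurrence m = begin
  M * rhs (suc m) + fromℕ (m ℕ.+ 2) * rhs m
    ≡⟨ cong₃ (λ a b c → M * a + b * c) (trans (rhs≡rhs-shape (suc m)) next) (fromℕ-+ m 2) (rhs≡rhs-shape m) ⟩
  M * rhs-shape (1ℚ + M) c′ (- σ) (s + c′ * i₁) + (M + fromℕ 2) * rhs-shape M (central m) σ s
    ≡⟨ rhs-recurrence-identity (central m) σ M s i₁ (reciprocal (suc m) refl (fromℕ-suc m)) ⟩
  c′ * σ * (fromℕ 3 * M + fromℕ 2) * inv 2
    ≡⟨ cong (λ z → z * σ * (fromℕ 3 * M + fromℕ 2) * inv 2) (central-suc m) ⟨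
  inhomogeneity m ∎
  where
  M = fromℕ m
  σ = sgn m
  s = Σ1to m (λ i → central i * inv i)
  i₁ = inv (suc m)
  c′ = (1ℚ + (1ℚ + (M + M))) * ((1ℚ + (M + M)) * central m * i₁) * i₁
  next : rhs-shape (fromℕ (suc m)) (central (suc m)) (- σ) (s + central (suc m) * i₁)
       ≡ rhs-shape (1ℚ + M) c′ (- σ) (s + c′ * i₁)
  next = cong₂ (λ N c → rhs-shape N c (- σ) (s + c * i₁)) (fromℕ-suc m) (central-suc m)

lhs-recurrence : ∀ k → recurrence lhs (suc k) ≡ inhomogeneity (suc k)
lhs-recurrence k = begin
  M * (Σ0to m (term (suc m)) + term (suc m) (suc m)) + fromℕ (m ℕ.+ 2) * Σ0to m (term m)
    ≡⟨ regroup M (Σ0to m (term (suc m))) (term (suc m) (suc m)) (fromℕ (m ℕ.+ 2)) (Σ0to m (term m)) ⟩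
  M * Σ0to m (term (suc m)) + fromℕ (m ℕ.+ 2) * Σ0to m (term m) + M * term (suc m) (suc m)
    ≡⟨ cong (_+ M * term (suc m) (suc m)) (Σ0to-linear m (term (suc m)) (term m) M (fromℕ (m ℕ.+ 2))) ⟨
  Σ0to k step + step m + M * term (suc m) (suc m)
    ≡⟨ cong (λ z → z + step m + M * term (suc m) (suc m)) telescoped ⟩
  certificateAt m m + step m + M * term (suc m) (suc m)
    ≡⟨ boundary m ⟩
  inhomogeneity m ∎
  where
  m = suc k
  M = fromℕ m
  step : ℕ → ℚ
  step j = M * term (suc m) j + fromℕ (m ℕ.+ 2) * term m j
  regroup : ∀ a s t b u → a * (s + t) + b * u ≡ a * s + b * u + a * t
  regroup a s t b u = trans (cong (_+ b * u) (ℚ.*-distribˡ-+ a s t)) (ℚ+.xy∙z≈xz∙y (a * s) (a * t) (b * u))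
  certificateAt-zero : certificateAt m 0 ≡ 0ℚ
  certificateAt-zero = certificate-at-zero (binomialWeight m 0) (inv (suc m)) M (harmonicPart m 0)
  telescoped : Σ0to k step ≡ certificateAt m m
  telescoped = begin
    Σ0to k step                       ≡⟨ ℚ.+-identityʳ (Σ0to k step) ⟨
    Σ0to k step + 0ℚ                  ≡⟨ cong (λ z → Σ0to k step + z) certificateAt-zero ⟨
    Σ0to k step + certificateAt m 0   ≡⟨ Σ0to-telescope k step (certificateAt m) (λ j j≤k → wz-step (ℕ.s≤s j≤k)) ⟩
    certificateAt m m                 ∎

lhs≡rhs : ∀ n → lhs (suc n) ≡ rhs (suc n)
lhs≡rhs = first-order-recurrence-unique
  (λ n → fromℕ (suc n)) (λ n → fromℕ (suc n ℕ.+ 2)) (λ n → inhomogeneity (suc n))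
  (λ n → lhs (suc n)) (λ n → rhs (suc n))
  (λ n → inv (suc n) , fromℕ*inv n) lhs-recurrence (λ n → rhs-recurrence (suc n)) refl

mainTheorem5 : (n : ℕ) → .{{_ : ℕ.NonZero n}} →
    Σ0to n (λ j → fromℕ ((n ℕ.+ j) C j) * fromℕ (n C j) * sgn j
                   * (1ℚ + fromℕ j * (H (n ℕ.+ j) + H (n ∸ j) - fromℕ 2 * H j)))
    ≡ fromℕ (1 ℕ.+ 2 ℕ.* n) * fromℕ ((2 ℕ.* n) C n) * sgn n
      - ((+ 3) / 2) * fromℕ n * fromℕ (1 ℕ.+ n) * sgn n
        * Σ1to n (λ i → fromℕ ((2 ℕ.* i) C i) * inv i)
mainTheorem5 (suc n) = lhs≡rhs n
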